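{- For every integer $p \ge 1$ there exist an integer $k$ and a $k$-colourable $(K_4, \text{diamond}, \text{paw}, \text{co-claw}, \text{co-diamond})$-free graph $G$ that is not $(k+p)$-mixing.
   Context: All graphs are finite and simple. A $k$-colouring of $G$ is a map $\alpha: V(G)\to\{1,\dots,k\}$ with $\alpha(u)\neq\alpha(v)$ for every edge $uv$; $G$ is $k$-colourable if one exists. The reconfiguration graph $\mathcal{R}_k(G)$ has the $k$-colourings of $G$ as vertices, two being adjacent if they differ on exactly one vertex; $G$ is $k$-mixing if $\mathcal{R}_k(G)$ is connected. A graph is $\mathcal{H}$-free if it contains no induced subgraph isomorphic to any member of $\mathcal{H}$. The diamond is $K_4$ minus one edge; the paw is a triangle with a pendant vertex attached to one triangle vertex; the co-claw is $K_3+K_1$ (a triangle plus an isolated vertex); the co-diamond is $K_2+2K_1$ (one edge plus two isolated vertices). -}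

module Defs where

open import Data.Fin using (Fin)
open import Data.Fin.Patterns using (0F; 1F; 2F; 3F)
open import Data.Fin.Properties using (_≟_)
open import Data.List using (List; []; _∷_)
open import Data.List.Membership.Propositional using (_∈_)
open import Data.List.Relation.Unary.All using (All)
open import Data.Nat using (ℕ)
open import Data.Product using (_×_; _,_; ∃!)
open import Data.Product.Properties using (≡-dec)
open import Data.Sum using (_⊎_; swap)
open import Function.Bundles using (_⇔_)
open import Function.Definitions using (Injective)
open import Level using (_⊔_; 0ℓ)
open import Relation.Binary.Construct.Closure.ReflexiveTransitive using (Star)
open import Relation.Binary.Construct.Union using (_∪_)
open import Relation.Binary.Core using (Rel)
open import Relation.Binary.Definitions using (Decidable; Symmetric)
open import Relation.Binary.PropositionalEquality using (_≡_; _≢_; _≗_; refl; ≢-sym)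
open import Relation.Nullary using (¬_)
open import Relation.Nullary.Decidable using (¬?; _×-dec_; _⊎-dec_)
import Data.List.Membership.DecPropositional as DecMembership

-- Decidable adjacency is automatic classically, and is what makes a graph on
-- Fin order a finite object constructively.
record Graph : Set₁ where
  field
    order   : ℕ
    Adj     : Rel (Fin order) 0ℓ
    adj?    : Decidable Adj
    sym     : Symmetric Adj
    irrefl  : ∀ {v} → ¬ Adj v v

  Vertex : Set
  Vertex = Fin order

open Graph using (Vertex; Adj)

complete : ℕ → Graph
complete n = record
  { order  = n
  ; Adj    = _≢_
  ; adj?   = λ u v → ¬? (u ≟ v)
  ; sym    = ≢-sym
  ; irrefl = λ v≢v → v≢v refl
  }

-- Each listed pair is read as an unordered edge; loops are discarded.
fromEdges : (n : ℕ) → List (Fin n × Fin n) → Graph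
fromEdges n es = record
  { order  = n
  ; Adj    = λ u v → u ≢ v × ((u , v) ∈ es ⊎ (v , u) ∈ es)
  ; adj?   = λ u v → ¬? (u ≟ v) ×-dec (((u , v) ∈? es) ⊎-dec ((v , u) ∈? es))
  ; sym    = λ (u≢v , e) → ≢-sym u≢v , swap e
  ; irrefl = λ (v≢v , _) → v≢v refl
  }
  where open DecMembership (≡-dec (_≟_ {n}) (_≟_ {n})) using (_∈?_)

K₄ diamond paw co-claw co-diamond : Graph
K₄         = complete 4
diamond    = fromEdges 4 ((0F , 1F) ∷ (0F , 2F) ∷ (1F , 2F) ∷ (1F , 3F) ∷ (2F , 3F) ∷ [])
paw        = fromEdges 4 ((0F , 1F) ∷ (0F , 2F) ∷ (1F , 2F) ∷ (2F , 3F) ∷ [])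
co-claw    = fromEdges 4 ((0F , 1F) ∷ (0F , 2F) ∷ (1F , 2F) ∷ [])
co-diamond = fromEdges 4 ((0F , 1F) ∷ [])

-- An isomorphism from H onto the subgraph of G induced by the image of embed.
record InducedCopy (H G : Graph) : Set where
  field
    embed     : Vertex H → Vertex G
    injective : Injective _≡_ _≡_ embed
    adj⇔      : ∀ {u v} → Adj H u v ⇔ Adj G (embed u) (embed v)

Free : List Graph → Graph → Set₁
Free 𝓗 G = All (λ H → ¬ InducedCopy H G) 𝓗

record Colouring (k : ℕ) (G : Graph) : Set where
  field
    colour : Vertex G → Fin k
    proper : ∀ {u v} → Adj G u v → colour u ≢ colour v

open Colouring using (colour)

Colourable : ℕ → Graph → Set
Colourable = Colouring

-- Connectivity of a graph on the setoid (V , _≈_): a walk may also pass between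
-- equal vertices.
Connected : ∀ {a ℓ₁ ℓ₂} {V : Set a} → Rel V ℓ₁ → Rel V ℓ₂ → Set (a ⊔ ℓ₁ ⊔ ℓ₂)
Connected _≈_ _~_ = ∀ u v → Star (_≈_ ∪ _~_) u v

module Reconfiguration (k : ℕ) (G : Graph) where

  -- Colourings are equal when they are equal as maps; without function
  -- extensionality this is weaker than _≡_ on the record.
  _≈_ : Rel (Colouring k G) 0ℓ
  α ≈ β = colour α ≗ colour β

  _~_ : Rel (Colouring k G) 0ℓ
  α ~ β = ∃! _≡_ λ v → colour α v ≢ colour β v

Mixing : ℕ → Graph → Set
Mixing k G = Connected _≈_ _~_
  where open Reconfiguration k G

{-# OPTIONS --safe #-}
-- Take G = K₂ × Kₙ, that is Kₙ,ₙ minus a perfect matching, with n = 2 + p. It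
-- is bipartite, and the two vertices missed by an edge are the partners of its
-- ends, which are adjacent; hence G has no induced co-diamond, and none of the
-- other four graphs since each contains a triangle. Giving each matched pair
-- its own colour is an n-colouring in which every vertex sees all colours but
-- its own, so no vertex can be recoloured.
module Submission where

open import Defs
open import Data.Empty using (⊥)
open import Data.Fin using (Fin; combine; opposite; remQuot; _↑ˡ_)
open import Data.Fin.Patterns using (0F; 1F; 2F; 3F)
open import Data.Fin.Properties using (_≟_; combine-remQuot; remQuot-combine; ↑ˡ-injective)
open import Data.List using ([]; _∷_)
open import Data.List.Relation.Unary.All using ([]; _∷_)
open import Data.List.Relation.Unary.Any using (here; there)
open import Data.Nat using (ℕ; _+_; _*_; _≤_)
open import Data.Product using (_×_; _,_; ∃-syntax; proj₁; proj₂)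
open import Data.Sum using (_⊎_; inj₁; inj₂)
open import Function.Base using (_∘_)
open import Function.Bundles using (Equivalence)
open import Function.Definitions using (Injective)
open import Relation.Binary.Construct.Closure.ReflexiveTransitive using (Star; ε; _◅_)
open import Relation.Binary.Construct.Union using (_∪_)
open import Relation.Binary.PropositionalEquality
open import Relation.Nullary using (¬_; yes; no; contradiction)
open import Relation.Nullary.Decidable using (¬?; _×-dec_; decidable-stable)

open Graph using (Vertex; Adj; irrefl)
open Colouring using (colour; proper)

module _ {k : ℕ} {G : Graph} where
  open Reconfiguration k G

  Frozen : Colouring k G → Set
  Frozen α = ∀ v c → c ≢ colour α v → ∃[ w ] Adj G v w × colour α w ≡ c

  -- Needed because a walk may also step between colourings that agree only pointwise.
  frozen-resp-≈ : ∀ {α β} → α ≈ β → Frozen α → Frozen β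
  frozen-resp-≈ α≈β frozen v c c≢βv =
    let w , vw , αw≡c = frozen v c (λ c≡αv → c≢βv (trans c≡αv (α≈β v)))
    in w , vw , trans (sym (α≈β w)) αw≡c

  -- The new colour of the one changed vertex `v` already sits on a neighbour `w`. As `w` differs
  -- from `v`, it keeps that colour, so the edge `vw` is monochromatic in `β`.
  frozen⇒isolated : ∀ {α β} → Frozen α → ¬ α ~ β
  frozen⇒isolated {α} {β} frozen (v , αv≢βv , unique) =
    let w , vw , αw≡βv = frozen v (colour β v) (≢-sym αv≢βv)
        αw≡βw = decidable-stable (colour α w ≟ colour β w)
                  (λ αw≢βw → irrefl G (subst (Adj G v) (sym (unique αw≢βw)) vw))
    in proper β vw (trans (sym αw≡βv) αw≡βw)

  frozen-walk : ∀ {α β} → Frozen α → Star (_≈_ ∪ _~_) α β → α ≈ β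
  frozen-walk frozen ε v = refl
  frozen-walk {α} {β} frozen (_◅_ {j = γ} (inj₁ α≈γ) walk) v =
    trans (α≈γ v) (frozen-walk {γ} {β} (frozen-resp-≈ {α} {γ} α≈γ frozen) walk v)
  frozen-walk {α} frozen (_◅_ {j = γ} (inj₂ α~γ) walk) =
    contradiction α~γ (frozen⇒isolated {α} {γ} frozen)

recolour : ∀ {k l G} (f : Fin k → Fin l) → Injective _≡_ _≡_ f →
           Colouring k G → Colouring l G
recolour f f-injective α = record
  { colour = f ∘ colour α
  ; proper = λ uv → proper α uv ∘ f-injective
  }

-- Distinctness of the three vertices follows from irreflexivity of adjacency.
Triangle : Graph → Set
Triangle G = ∃[ u ] ∃[ v ] ∃[ w ] Adj G u v × Adj G u w × Adj G v w

triangle-copy : ∀ {H G} → InducedCopy H G → Triangle H → Triangle G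
triangle-copy copy (u , v , w , uv , uw , vw) =
  embed u , embed v , embed w , to adj⇔ uv , to adj⇔ uw , to adj⇔ vw
  where open InducedCopy copy
        open Equivalence using (to)

≢-≢⇒≡ : {i j k : Fin 2} → i ≢ j → i ≢ k → j ≡ k
≢-≢⇒≡ {0F} {0F}      i≢j _   = contradiction refl i≢j
≢-≢⇒≡ {0F} {1F} {0F} _   i≢k = contradiction refl i≢k
≢-≢⇒≡ {0F} {1F} {1F} _   _   = refl
≢-≢⇒≡ {1F} {0F} {0F} _   _   = refl
≢-≢⇒≡ {1F} {0F} {1F} _   i≢k = contradiction refl i≢k
≢-≢⇒≡ {1F} {1F}      i≢j _   = contradiction refl i≢j

opposite-≢ : (i : Fin 2) → i ≢ opposite i
opposite-≢ 0F ()
opposite-≢ 1F ()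

bipartite⇒triangle-free : ∀ {G} → Colourable 2 G → ¬ Triangle G
bipartite⇒triangle-free α (u , v , w , uv , uw , vw) =
  proper α vw (≢-≢⇒≡ (proper α uv) (proper α uw))

module Crown (n : ℕ) where

  -- Vertices must form a `Fin order`, so a pair (side, index) is coded by `combine` and decoded by
  -- `remQuot`.
  vertex : Fin 2 → Fin n → Fin (2 * n)
  vertex = combine

  side : Fin (2 * n) → Fin 2
  side v = proj₁ (remQuot n v)

  index : Fin (2 * n) → Fin n
  index v = proj₂ (remQuot {2} n v)

  side-vertex : ∀ s i → side (vertex s i) ≡ s
  side-vertex s i = cong proj₁ (remQuot-combine {2} {n} s i)

  index-vertex : ∀ s i → index (vertex s i) ≡ i
  index-vertex s i = cong proj₂ (remQuot-combine {2} {n} s i)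

  side-index-injective : ∀ {u v} → side u ≡ side v → index u ≡ index v → u ≡ v
  side-index-injective {u} {v} s≡ i≡ =
    trans (sym (combine-remQuot {2} n u))
          (trans (cong₂ vertex s≡ i≡) (combine-remQuot {2} n v))

  crown : Graph
  crown = record
    { order  = 2 * n
    ; Adj    = λ u v → side u ≢ side v × index u ≢ index v
    ; adj?   = λ u v → ¬? (side u ≟ side v) ×-dec ¬? (index u ≟ index v)
    ; sym    = λ (s≢ , i≢) → ≢-sym s≢ , ≢-sym i≢
    ; irrefl = λ (s≢ , _) → s≢ refl
    }

  by-side : Colouring 2 crown
  by-side = record { colour = side ; proper = proj₁ }

  by-index : Colouring n crown
  by-index = record { colour = index ; proper = proj₂ }

  -- The neighbour of `v` coloured `c` is the vertex of index `c` on the other side.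
  by-index-frozen : Frozen by-index
  by-index-frozen v c c≢v = w , (s≢ , i≢) , index-vertex (opposite (side v)) c
    where
    w = vertex (opposite (side v)) c
    s≢ : side v ≢ side w
    s≢ e = opposite-≢ (side v) (trans e (side-vertex (opposite (side v)) c))
    i≢ : index v ≢ index w
    i≢ e = c≢v (sym (trans e (index-vertex (opposite (side v)) c)))

  -- The pairs of the deleted perfect matching.
  Partner : Vertex crown → Vertex crown → Set
  Partner u v = side u ≢ side v × index u ≡ index v

  partner-unique : ∀ {u v w} → Partner u v → Partner u w → v ≡ w
  partner-unique (s≢ , i≡) (s≢′ , i≡′) =
    side-index-injective (≢-≢⇒≡ s≢ s≢′) (trans (sym i≡) i≡′)

  non-adjacent⇒partner : ∀ {u v} → side u ≢ side v → ¬ Adj crown u v → Partner u v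
  non-adjacent⇒partner {u} {v} s≢ ¬uv =
    s≢ , decidable-stable (index u ≟ index v) (λ i≢ → ¬uv (s≢ , i≢))

  -- The ends of an edge lie on different sides, so `w` is across from one of them; across the
  -- sides, only partners are non-adjacent.
  missed-by-edge : ∀ {u v w} → Adj crown u v → ¬ Adj crown u w → ¬ Adj crown v w →
                   Partner u w ⊎ Partner v w
  missed-by-edge {u} {v} {w} (s≢ , _) ¬uw ¬vw with side u ≟ side w
  ... | no su≢sw  = inj₁ (non-adjacent⇒partner su≢sw ¬uw)
  ... | yes su≡sw =
    inj₂ (non-adjacent⇒partner (λ sv≡sw → s≢ (trans su≡sw (sym sv≡sw))) ¬vw)

  -- Passing to partners swaps the two sides and keeps both indices.
  partners-adjacent : ∀ {u v w x} → Adj crown u v → Partner u w → Partner v x →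
                      Adj crown w x
  partners-adjacent (s≢ , i≢) (su≢sw , iu≡iw) (sv≢sx , iv≡ix) =
    (λ sw≡sx → s≢ (≢-≢⇒≡ (≢-sym su≢sw) (λ sw≡sv → sv≢sx (trans (sym sw≡sv) sw≡sx)))) ,
    (λ iw≡ix → i≢ (trans iu≡iw (trans iw≡ix (sym iv≡ix))))

  co-diamond-free : ¬ InducedCopy co-diamond crown
  co-diamond-free copy = absurd
    -- Both isolated vertices are partners of ends of the edge: of the same end, they coincide; of
    -- different ends, they are adjacent.
    (missed-by-edge e₀₁ (reflect λ { (_ , inj₁ (here ())) ; (_ , inj₂ (here ())) })
                        (reflect λ { (_ , inj₁ (here ())) ; (_ , inj₂ (here ())) }))
    (missed-by-edge e₀₁ (reflect λ { (_ , inj₁ (here ())) ; (_ , inj₂ (here ())) })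
                        (reflect λ { (_ , inj₁ (here ())) ; (_ , inj₂ (here ())) }))
    where
    open InducedCopy copy
    open Equivalence using (to; from)

    reflect : ∀ {u v} → ¬ Adj co-diamond u v → ¬ Adj crown (embed u) (embed v)
    reflect ¬uv = ¬uv ∘ from adj⇔

    e₀₁ : Adj crown (embed 0F) (embed 1F)
    e₀₁ = to adj⇔ ((λ ()) , inj₁ (here refl))

    w≢x : embed 2F ≢ embed 3F
    w≢x e with () ← injective e

    ¬wx : ¬ Adj crown (embed 2F) (embed 3F)
    ¬wx = reflect λ { (_ , inj₁ (here ())) ; (_ , inj₂ (here ())) }

    absurd : Partner (embed 0F) (embed 2F) ⊎ Partner (embed 1F) (embed 2F) →
             Partner (embed 0F) (embed 3F) ⊎ Partner (embed 1F) (embed 3F) → ⊥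
    absurd (inj₁ uw) (inj₁ ux) = w≢x (partner-unique uw ux)
    absurd (inj₁ uw) (inj₂ vx) = ¬wx (partners-adjacent e₀₁ uw vx)
    absurd (inj₂ vw) (inj₁ ux) = ¬wx (Graph.sym crown (partners-adjacent e₀₁ ux vw))
    absurd (inj₂ vw) (inj₂ vx) = w≢x (partner-unique vw vx)

  triangle⇒free : ∀ {H} → Triangle H → ¬ InducedCopy H crown
  triangle⇒free t copy = bipartite⇒triangle-free by-side (triangle-copy copy t)

  crown-free : Free (K₄ ∷ diamond ∷ paw ∷ co-claw ∷ co-diamond ∷ []) crown
  crown-free =
      triangle⇒free (0F , 1F , 2F , (λ ()) , (λ ()) , (λ ()))
    ∷ triangle⇒free listed
    ∷ triangle⇒free listed
    ∷ triangle⇒free listed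
    ∷ co-diamond-free
    ∷ []
    where
    -- The edge lists of `diamond`, `paw` and `co-claw` share their first three edges, which form a
    -- triangle.
    listed : ∀ {es} →
             Triangle (fromEdges 4 ((0F , 1F) ∷ (0F , 2F) ∷ (1F , 2F) ∷ es))
    listed = 0F , 1F , 2F ,
      ((λ ()) , inj₁ (here refl)) ,
      ((λ ()) , inj₁ (there (here refl))) ,
      ((λ ()) , inj₁ (there (there (here refl))))

crown-not-mixing : ∀ p → ¬ Mixing (2 + p) (Crown.crown (2 + p))
crown-not-mixing p mixing = 1≢0 (begin
  1F                       ≡⟨ index-vertex 0F 1F ⟨
  index (vertex 0F 1F)     ≡⟨ index≗side (vertex 0F 1F) ⟩
  side (vertex 0F 1F) ↑ˡ p ≡⟨ cong (_↑ˡ p) (side-vertex 0F 1F) ⟩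
  0F                       ∎)
  where
  open Crown (2 + p)
  open ≡-Reasoning

  1≢0 : _≢_ {A = Fin (2 + p)} 1F 0F
  1≢0 ()

  two-coloured : Colouring (2 + p) crown
  two-coloured = recolour (_↑ˡ p) (↑ˡ-injective p _ _) by-side

  index≗side : ∀ v → index v ≡ side v ↑ˡ p
  index≗side = frozen-walk {α = by-index} {β = two-coloured} by-index-frozen
                 (mixing by-index two-coloured)

theorem5 : (p : ℕ) → 1 ≤ p →
    ∃[ k ] ∃[ G ] Colourable k G
    × Free (K₄ ∷ diamond ∷ paw ∷ co-claw ∷ co-diamond ∷ []) G
    × ¬ Mixing (k + p) G
-- With `k = 2`, the number of colours `k + p` is exactly the number `2 + p` of matched pairs.
theorem5 p _ = 2 , crown , by-side , crown-free , crown-not-mixing p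
  where open Crown (2 + p)
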